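{- Let $B$ be a finite set of Boolean functions, let $k\ge 0$, let $\mathcal F$ be a class of frames, and let $M\subseteq\{\Box,\Diamond\}$. Then the following holds: (1) $\mathcal F\text{ - }\mathsf{CTAUT}_M^k(B)\equiv_m^{\log}\overline{\mathcal F\text{ - }\mathsf{CSAT}_{\mathrm{dual}(M)}^k(\mathrm{dual}(B))}$. (2) $\mathcal F\text{ - }\mathsf{FTAUT}_M^k(B)\equiv_m^{\log}\overline{\mathcal F\text{ - }\mathsf{FSAT}_{\mathrm{dual}(M)}^k(\mathrm{dual}(B))}$.
   Context: $A\le_m^{\log}A'$ denotes logarithmic-space many-one reducibility, and $A\equiv_m^{\log}A'$ means $A\le_m^{\log}A'$ and $A'\le_m^{\log}A$. The overline denotes the complementary decision problem (complement taken within the set of admissible instances, i.e. within the circuits, resp. formulas, of the given type). Duals. For an $n$-ary Boolean function $f$, $\mathrm{dual}(f)(x_1,\dots,x_n)=\neg f(\overline{x_1},\dots,\overline{x_n})$; $\mathrm{dual}(B)=\{\mathrm{dual}(f): f\in B\}$. For $M\subseteq\{\Box,\Diamond\}$, $\mathrm{dual}(M)$ is the set with $\Box\in\mathrm{dual}(M)$ iff $\Diamond\in M$, and $\Diamond\in\mathrm{dual}(M)$ iff $\Box\in M$. Semantics. Fix a countably infinite set $X$ of propositional variables. A $k$-modal frame is $(W,R_1,\dots,R_k)$ with $W$ a set of worlds and $R_i\subseteq W\times W$. For a class $\mathcal F$ of (uni-modal) frames $(W,R)$, $\mathcal F_k$ is the class of $k$-modal frames with $(W,R_i)\in\mathcal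 F$ for all $i\in\{1,\dots,k\}$. A model $\mathcal M$ is a frame with a map $\pi\colon X\to\mathcal P(W)$; it is an $\mathcal F_k$-model if its frame is in $\mathcal F_k$. $\mathcal M,w\models x$ iff $w\in\pi(x)$; Boolean functions are evaluated at each world in the usual way; $\mathcal M,w\models\Diamond_i\varphi$ iff some $w'$ with $(w,w')\in R_i$ has $\mathcal M,w'\models\varphi$; $\Box_i\varphi$ means $\neg\Diamond_i\neg\varphi$. A formula is $\mathcal F_k$-satisfiable if it holds at some world of some $\mathcal F_k$-model, and an $\mathcal F_k$-tautology if it holds at every world of every $\mathcal F_k$-model. Circuits and formulas. $\mathrm{MCIRC}_M^k(B)$ is the set of circuits, i.e. finite directed acyclic graphs with ordered incoming edges and a designated output gate, whose gates of in-degree $0$ are labeled by variables or $0$-ary functions (constants) of $B$, and whose gates of in-degree $d>0$ are labeled by $d$-ary functions of $B$ or, if $d=1$, by $\Box_i$ (if $\Box\in M$) or $\Diamond_i$ (if $\Diamond\in M$), $1\le i\le k$. A circuit represents the modal formula obtained by unfolding it (its formula expansion), and is satisfiable / a tautology iff that formula is. $\mathrm{MFORM}_M^k(B)$ is the set of formula expansions of circuits in $\mathrm{MCIRC}_M^k(B)$. $\mathcal F\text{ - }\mathsf{FSAT}_M^k(B)$ and $\mathcal F\text{ - }\mathsf{CSAT}_M^k(B)$ are the problems of deciding whether a given formula in $\mathrm{MFORM}_M^k(B)$, resp. circuit in $\mathrm{MCIRC}_M^k(B)$, is $\mathcal F_k$-satisfiable; $\mathcal F\text{ - }\mathsf{FTAUT}_M^k(B)$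 and $\mathcal F\text{ - }\mathsf{CTAUT}_M^k(B)$ are the analogous problems of deciding whether it is an $\mathcal F_k$-tautology. -}

module Defs where

open import Data.Bool.Base using (Bool; true; not; T; if_then_else_)
open import Data.Digit using (Bit; toDigits)
open import Data.Fin.Base using (Fin; zero; toℕ)
open import Data.Fin.Induction using (spo-wellFounded)
open import Data.List.Base
  using (List; []; _∷_; _++_; length; map; concatMap; allFin; fromMaybe;
         cartesianProductWith)
open import Data.List.Membership.Propositional using (_∈_)
open import Data.List.Membership.Propositional.Properties
  using (∈-map⁺; ∈-++⁺ˡ; ∈-++⁺ʳ; ∈-allFin; ∈-cartesianProductWith⁺)
open import Data.List.Relation.Unary.Any using (here; there)
open import Data.List.Relation.Unary.Enumerates.Setoid using (IsEnumeration)
open import Data.Maybe.Base as Maybe using (Maybe; just; nothing)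
open import Data.Nat.Base using (ℕ; zero; suc; pred; _*_; _⊓_; _≤_)
open import Data.Nat.Logarithm using (⌊log₂_⌋)
open import Data.Nat.Properties using (_≟_)
open import Data.Product.Base using (Σ-syntax; ∃-syntax; _×_; _,_; proj₁; proj₂)
open import Data.Unit.Polymorphic.Base using (⊤)
open import Data.Vec.Base as Vec using (Vec; []; _∷_; lookup; tabulate)
import Data.Vec.Functional as Family
open import Function.Bundles using (_⇔_)
open import Induction.WellFounded using (WellFounded; Acc; acc)
open import Level using (Level; 0ℓ; _⊔_) renaming (suc to lsuc)
open import Relation.Binary.Construct.Closure.ReflexiveTransitive using (Star)
open import Relation.Binary.Construct.Closure.Transitive
  using (TransClosure; wellFounded⁻) renaming (_++_ to _++⁺_)
open import Relation.Binary.Core using (Rel)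
open import Relation.Binary.PropositionalEquality
  using (_≡_; refl; isEquivalence; resp₂; setoid)
open import Relation.Nullary using (¬_; does)
open import Relation.Unary using (Pred)

-- A deterministic Turing machine with a read-only two-way input tape, one
-- read/write work tape and a write-only one-way output tape.  The state set
-- and the work alphabet are finite.

data Cell (A : Set) : Set where
  leftEnd rightEnd : Cell A
  symbol           : A → Cell A

data Move : Set where
  left stay right : Move

record Action (Q W C : Set) : Set where
  field
    nextState : Q
    inputMove : Move
    write     : W
    workMove  : Move
    emit      : Maybe C

record Transducer (A C : Set) : Set where
  field
    states      : ℕ
    workSymbols : ℕ
    start       : Fin states
    -- The work alphabet has 1 + workSymbols letters, zero being the blank;
    -- the value nothing means that the machine halts.
    δ : Fin states → Cell A → Fin (suc workSymbols) →
        Maybe (Action (Fin states) (Fin (suc workSymbols)) C)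

-- Input positions are 0 (left end marker), 1, …, length input, and
-- 1 + length input (right end marker).
readAt : {A : Set} → List A → ℕ → Cell A
readAt _        zero          = leftEnd
readAt []       (suc _)       = rightEnd
readAt (a ∷ _)  (suc zero)    = symbol a
readAt (_ ∷ as) (suc (suc i)) = readAt as (suc i)

moveHead : Move → ℕ → ℕ
moveHead left  i = pred i
moveHead stay  i = i
moveHead right i = suc i

module Run {A C : Set} (𝕋 : Transducer A C) (input : List A) where
  open Transducer 𝕋

  record Config : Set where
    field
      state     : Fin states
      inputHead : ℕ
      work      : ℕ → Fin (suc workSymbols)
      workHead  : ℕ
      output    : List C

  -- The input head cannot leave the marked input: otherwise its position
  -- would be an unbounded counter not accounted for in the space bound.
  moveInput : Move → ℕ → ℕ
  moveInput d i = moveHead d i ⊓ suc (length input)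

  perform : Config → Action (Fin states) (Fin (suc workSymbols)) C → Config
  perform c a = record
    { state     = nextState
    ; inputHead = moveInput inputMove inputHead
    ; work      = λ i → if does (i ≟ workHead) then write else work i
    ; workHead  = moveHead workMove workHead
    ; output    = output ++ fromMaybe emit
    }
    where
    open Config c
    open Action a

  step : Config → Maybe Config
  step c = Maybe.map (perform c) (δ state (readAt input inputHead) (work workHead))
    where
    open Config c

  _⟶_ : Rel Config 0ℓ
  c ⟶ c′ = step c ≡ just c′

  initial : Config
  initial = record
    { state = start ; inputHead = 0 ; work = λ _ → zero ; workHead = 0 ; output = [] }

  HaltsWith : List C → Set
  HaltsWith y = ∃[ c ] Star _⟶_ initial c × step c ≡ nothing × Config.output c ≡ y

  UsesSpace≤ : ℕ → Set
  UsesSpace≤ s = ∀ c → Star _⟶_ initial c → suc (Config.workHead c) ≤ s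

LogSpaceComputable : {A C : Set} → (List A → List C) → Set
LogSpaceComputable {A} {C} f =
  Σ[ 𝕋 ∈ Transducer A C ]
    (∀ x → Run.HaltsWith 𝕋 x (f x)) ×
    (∃[ a ] ∀ x → Run.UsesSpace≤ 𝕋 x (a * suc ⌊log₂ length x ⌋))

record Problem (a : Level) : Set (lsuc a) where
  field
    Alphabet       : Set
    finiteAlphabet : ∃[ xs ] IsEnumeration (setoid Alphabet) xs
    Instance       : Set
    encode         : Instance → List Alphabet
    Yes            : Pred Instance a

-- The complement is taken within the admissible instances.
complement : ∀ {a} → Problem a → Problem a
complement P = record P { Yes = λ x → ¬ Problem.Yes P x }

infix 4 _≤ₘˡᵒᵍ_ _≡ₘˡᵒᵍ_

_≤ₘˡᵒᵍ_ : ∀ {a b} → Problem a → Problem b → Set (a ⊔ b)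
P ≤ₘˡᵒᵍ P′ =
  Σ[ f ∈ (List P.Alphabet → List P′.Alphabet) ]
    LogSpaceComputable f ×
    (∀ (x : P.Instance) → Σ[ y ∈ P′.Instance ]
       P′.encode y ≡ f (P.encode x) × (P.Yes x ⇔ P′.Yes y))
  where
  module P  = Problem P
  module P′ = Problem P′

_≡ₘˡᵒᵍ_ : ∀ {a b} → Problem a → Problem b → Set (a ⊔ b)
P ≡ₘˡᵒᵍ P′ = (P ≤ₘˡᵒᵍ P′) × (P′ ≤ₘˡᵒᵍ P)

BoolFun : Set
BoolFun = Σ[ n ∈ ℕ ] (Vec Bool n → Bool)

-- A finite set of Boolean functions is given by a finite family listing its
-- elements, possibly with repetitions.
BoolFuns : ℕ → Set
BoolFuns = Family.Vector BoolFun

dualFun : BoolFun → BoolFun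
dualFun (n , f) = n , λ xs → not (f (Vec.map not xs))

dualFuns : ∀ {m} → BoolFuns m → BoolFuns m
dualFuns = Family.map dualFun

data Modality : Set where
  □ ◇ : Modality

ModalitySet : Set
ModalitySet = Modality → Bool

dualModalities : ModalitySet → ModalitySet
dualModalities M □ = M ◇
dualModalities M ◇ = M □

-- The i-th member of the family B is named by its index i : Fin m.
data Label (M : ModalitySet) (k m : ℕ) : Set where
  var : ℕ → Label M k m
  fun : Fin m → Label M k m
  mod : (o : Modality) → T (M o) → Fin k → Label M k m

arity : ∀ {M k m} → BoolFuns m → Label M k m → ℕ
arity B (var _)     = 0
arity B (fun i)     = proj₁ (B i)
arity B (mod _ _ _) = 1

data Formula (M : ModalitySet) (k : ℕ) {m : ℕ} (B : BoolFuns m) : Set where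
  node : (l : Label M k m) → Vec (Formula M k B) (arity B l) → Formula M k B

-- inputs g lists the sources of the ordered incoming edges of gate g; parallel
-- edges are allowed.
record Circuit (M : ModalitySet) (k : ℕ) {m : ℕ} (B : BoolFuns m) : Set where
  field
    size   : ℕ
    label  : Fin size → Label M k m
    inputs : (g : Fin size) → Vec (Fin size) (arity B (label g))
    output : Fin size

  _⇝_ : Rel (Fin size) 0ℓ
  h ⇝ g = ∃[ j ] lookup (inputs g) j ≡ h

  field
    acyclic : ∀ g → ¬ TransClosure _⇝_ g g

  ⇝-wellFounded : WellFounded _⇝_
  ⇝-wellFounded = wellFounded⁻ _ (spo-wellFounded record
    { isEquivalence = isEquivalence
    ; irrefl        = λ { refl → acyclic _ }
    ; trans         = _++⁺_
    ; <-resp-≈      = resp₂ _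
    })

  unfoldGate : ∀ g → Acc _⇝_ g → Formula M k B
  unfoldGate g (acc rs) =
    node (label g) (tabulate λ j → unfoldGate (lookup (inputs g) j) (rs (j , refl)))

  expansion : Formula M k B
  expansion = unfoldGate output (⇝-wellFounded output)

MCIRC : (M : ModalitySet) (k : ℕ) {m : ℕ} → BoolFuns m → Set
MCIRC = Circuit

MFORM : (M : ModalitySet) (k : ℕ) {m : ℕ} → BoolFuns m → Set
MFORM M k B = Σ[ φ ∈ Formula M k B ] ∃[ c ] Circuit.expansion {M} {k} {B = B} c ≡ φ

record Frame (ℓ : Level) : Set (lsuc ℓ) where
  constructor ⟨_,_⟩
  field
    World : Set ℓ
    R     : Rel World ℓ

FrameClass : (ℓ p : Level) → Set (lsuc ℓ ⊔ lsuc p)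
FrameClass ℓ p = Pred (Frame ℓ) p

record KFrame (k : ℕ) (ℓ : Level) : Set (lsuc ℓ) where
  field
    World : Set ℓ
    R     : Fin k → Rel World ℓ

record Model (k : ℕ) (ℓ : Level) : Set (lsuc ℓ) where
  field
    frame : KFrame k ℓ
  open KFrame frame public
  field
    π : ℕ → Pred World ℓ

InClass : ∀ {ℓ p} → FrameClass ℓ p → (k : ℕ) → Pred (KFrame k ℓ) p
InClass 𝓕 k fr = ∀ i → 𝓕 ⟨ World , R i ⟩
  where
  open KFrame fr

module _ {k ℓ} (𝓜 : Model k ℓ) {M : ModalitySet} {m : ℕ} {B : BoolFuns m} where
  open Model 𝓜

  -- Satisfaction is a proposition, so a Boolean function f is applied to the
  -- unique Boolean vector of truth values of its arguments.
  mutual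
    infix 4 _⊨_
    _⊨_ : World → Formula M k B → Set ℓ
    w ⊨ node (var x) []            = π x w
    w ⊨ node (fun i) φs            = ∃[ bs ] TruthValues w φs bs × proj₂ (B i) bs ≡ true
    w ⊨ node (mod ◇ _ i) (φ ∷ [])  = ∃[ w′ ] R i w w′ × (w′ ⊨ φ)
    w ⊨ node (mod □ _ i) (φ ∷ [])  = ¬ (∃[ w′ ] R i w w′ × ¬ (w′ ⊨ φ))

    TruthValues : ∀ {n} → World → Vec (Formula M k B) n → Vec Bool n → Set ℓ
    TruthValues w []       []       = ⊤
    TruthValues w (φ ∷ φs) (b ∷ bs) = (b ≡ true ⇔ w ⊨ φ) × TruthValues w φs bs

Satisfiable : ∀ {ℓ p M k m} {B : BoolFuns m} →
              FrameClass ℓ p → Formula M k B → Set (lsuc ℓ ⊔ p)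
Satisfiable {ℓ} {k = k} 𝓕 φ =
  Σ[ 𝓜 ∈ Model k ℓ ] InClass 𝓕 k (Model.frame 𝓜) × (∃[ w ] _⊨_ 𝓜 w φ)

Tautology : ∀ {ℓ p M k m} {B : BoolFuns m} →
            FrameClass ℓ p → Formula M k B → Set (lsuc ℓ ⊔ p)
Tautology {ℓ} {k = k} 𝓕 φ =
  (𝓜 : Model k ℓ) → InClass 𝓕 k (Model.frame 𝓜) → ∀ w → _⊨_ 𝓜 w φ

data Symbol (k m : ℕ) : Set where
  varS sepS : Symbol k m
  bitS      : Bit → Symbol k m
  funS      : Fin m → Symbol k m
  modS      : Modality → Fin k → Symbol k m

symbols : ∀ k m → List (Symbol k m)
symbols k m =
  varS ∷ sepS ∷ (map bitS (allFin 2) ++ (map funS (allFin m) ++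
    cartesianProductWith modS (□ ∷ ◇ ∷ []) (allFin k)))

symbols-complete : ∀ k m → IsEnumeration (setoid (Symbol k m)) (symbols k m)
symbols-complete k m varS       = here refl
symbols-complete k m sepS       = there (here refl)
symbols-complete k m (bitS b)   = there (there (∈-++⁺ˡ (∈-map⁺ bitS (∈-allFin b))))
symbols-complete k m (funS i)   =
  there (there (∈-++⁺ʳ (map bitS (allFin 2)) (∈-++⁺ˡ (∈-map⁺ funS (∈-allFin i)))))
symbols-complete k m (modS o i) =
  there (there (∈-++⁺ʳ (map bitS (allFin 2)) (∈-++⁺ʳ (map funS (allFin m))
    (∈-cartesianProductWith⁺ modS (o∈ o) (∈-allFin i)))))
  where
  o∈ : ∀ o → o ∈ (□ ∷ ◇ ∷ [])
  o∈ □ = here refl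
  o∈ ◇ = there (here refl)

-- Least significant bit first.
binary : ∀ {k m} → ℕ → List (Symbol k m)
binary n = map bitS (proj₁ (toDigits 2 n))

encodeLabel : ∀ {M k m} → Label M k m → List (Symbol k m)
encodeLabel (var x)     = varS ∷ binary x
encodeLabel (fun i)     = funS i ∷ []
encodeLabel (mod o _ i) = modS o i ∷ []

-- The address of the output gate, followed for each gate by its label and the
-- addresses of its inputs, each preceded by a separator.
encodeCircuit : ∀ {M k m} {B : BoolFuns m} → Circuit M k B → List (Symbol k m)
encodeCircuit c = binary (toℕ output) ++ concatMap encodeGate (allFin size)
  where
  open Circuit c
  encodeGate = λ g → encodeLabel (label g) ++
    concatMap (λ h → sepS ∷ binary (toℕ h)) (Vec.toList (inputs g))

-- Polish notation.
mutual
  encodeFormula : ∀ {M k m} {B : BoolFuns m} → Formula M k B → List (Symbol k m)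
  encodeFormula (node l φs) = encodeLabel l ++ encodeFormulas φs

  encodeFormulas : ∀ {M k m n} {B : BoolFuns m} →
                   Vec (Formula M k B) n → List (Symbol k m)
  encodeFormulas []       = []
  encodeFormulas (φ ∷ φs) = encodeFormula φ ++ encodeFormulas φs

module _ {ℓ p : Level} (𝓕 : FrameClass ℓ p) (M : ModalitySet) (k : ℕ)
         {m : ℕ} (B : BoolFuns m) where

  circuitProblem : Pred (Formula M k B) (lsuc ℓ ⊔ p) → Problem (lsuc ℓ ⊔ p)
  circuitProblem P = record
    { Alphabet       = Symbol k m
    ; finiteAlphabet = symbols k m , symbols-complete k m
    ; Instance       = MCIRC M k B
    ; encode         = encodeCircuit
    ; Yes            = λ c → P (Circuit.expansion c)
    }

  formulaProblem : Pred (Formula M k B) (lsuc ℓ ⊔ p) → Problem (lsuc ℓ ⊔ p)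
  formulaProblem P = record
    { Alphabet       = Symbol k m
    ; finiteAlphabet = symbols k m , symbols-complete k m
    ; Instance       = MFORM M k B
    ; encode         = λ φ → encodeFormula (proj₁ φ)
    ; Yes            = λ φ → P (proj₁ φ)
    }

  CSAT CTAUT FSAT FTAUT : Problem (lsuc ℓ ⊔ p)
  CSAT  = circuitProblem (Satisfiable 𝓕)
  CTAUT = circuitProblem (Tautology 𝓕)
  FSAT  = formulaProblem (Satisfiable 𝓕)
  FTAUT = formulaProblem (Tautology 𝓕)

{-# OPTIONS --safe #-}
-- Exchanging □ with ◇ and each function of B with its dual turns φ into a
-- formula φᵈ that is true in a model exactly where φ is false in the model with
-- the complemented valuation; hence φ is a tautology iff φᵈ is unsatisfiable.
-- On encodings this acts letter by letter, because a member of dual(B) has the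
-- same index as the function it comes from; a letter-to-letter map is computed
-- by one pass over the input without using the work tape.
module Submission where

open import Defs
open import Axiom.ExcludedMiddle using (ExcludedMiddle)
open import Data.Bool.Base using (Bool; true; false; not; T)
open import Data.Bool.Properties using (not-involutive; not-¬; ¬-not; ⇔→≡)
open import Data.Fin.Base using (Fin; zero; suc; toℕ)
open import Data.List.Base as List using (List; []; _∷_; _++_; length; concatMap; allFin)
open import Data.List.Properties
  using (map-++; map-∘; map-concatMap; concatMap-cong; ++-assoc; ++-identityʳ)
open import Data.Maybe.Base using (just; nothing)
open import Data.Nat.Base using (ℕ; zero; suc; _+_; _≤_; z≤n; s≤s)
open import Data.Nat.Properties using (+-suc; +-identityʳ; m≤m+n; m≤n⇒m⊓n≡m)
open import Data.Product.Base using (∃-syntax; _×_; _,_; proj₁; proj₂)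
open import Data.Vec.Base as Vec using (Vec; []; _∷_; lookup; tabulate)
import Data.Vec.Properties as Vec
open import Function.Base using (_∘_; id)
open import Function.Bundles using (_⇔_; mk⇔; module Equivalence)
open import Induction.WellFounded using (Acc; acc)
open import Level using (Level; _⊔_) renaming (suc to lsuc)
open import Relation.Binary.Construct.Closure.ReflexiveTransitive using (Star; ε; _◅_)
open import Relation.Binary.Construct.Closure.Transitive using (TransClosure; [_]; _∷_)
open import Relation.Binary.PropositionalEquality
  using (_≡_; refl; sym; trans; cong; cong₂; subst; module ≡-Reasoning)
open import Relation.Nullary using (¬_; yes; no; contradiction)
open import Relation.Nullary.Decidable using (decidable-stable)
open import Relation.Unary using (Pred)

open Equivalence using (to; from)

-- Letter-to-letter maps in logarithmic space.

module _ {A C : Set} (h : A → C) where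

  private
    scan : List C → Action (Fin 1) (Fin 1) C
    scan ys = record
      { nextState = zero ; inputMove = right ; write = zero ; workMove = stay
      ; emit = List.head ys }

  mapTransducer : Transducer A C
  mapTransducer = record
    { states      = 1
    ; workSymbols = 0
    ; start       = zero
    ; δ           = λ { _ leftEnd    _ → just (scan [])
                      ; _ (symbol a) _ → just (scan (h a ∷ []))
                      ; _ rightEnd   _ → nothing }
    }

  module _ (input : List A) where
    open Run mapTransducer input

    -- As long as a letter is unread, the cut-off of the input head at the right end marker has no
    -- effect.
    scan-right : ∀ {i} a (as : List A) → i + length (a ∷ as) ≡ length input →
                 moveInput right (suc i) ≡ suc (suc i)
    scan-right {i} a as len = m≤n⇒m⊓n≡m (s≤s (subst (suc i ≤_)
      (trans (sym (+-suc i (length as))) len) (m≤m+n (suc i) (length as))))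

    -- Invariant of the pass: `i` letters have been read and `as` is the unread suffix. The head
    -- stands at `suc i` because position 0 holds the left end marker.
    run-map : ∀ i as (c : Config) → Config.inputHead c ≡ suc i →
              (∀ j → readAt input (suc (i + j)) ≡ readAt as (suc j)) →
              i + length as ≡ length input →
              ∃[ c′ ] Star _⟶_ c c′ × step c′ ≡ nothing ×
                      Config.output c′ ≡ Config.output c ++ List.map h as
    run-map i [] c refl unread len =
      c , ε , halted , sym (++-identityʳ _)
      where
      halted : step c ≡ nothing
      halted rewrite trans (cong (readAt input ∘ suc) (sym (+-identityʳ i))) (unread 0) = refl
    run-map i (a ∷ as) c refl unread len
      with run-map (suc i) as (perform c (scan (h a ∷ []))) (scan-right a as len)
             (λ j → trans (cong (readAt input ∘ suc) (sym (+-suc i j))) (unread (suc j)))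
             (trans (sym (+-suc i (length as))) len)
    ... | c′ , run , halt , out =
      c′ , first ◅ run , halt , trans out (++-assoc (Config.output c) (h a ∷ []) _)
      where
      first : step c ≡ just (perform c (scan (h a ∷ [])))
      first rewrite trans (cong (readAt input ∘ suc) (sym (+-identityʳ i))) (unread 0) = refl

    workHead-fixed : ∀ {c c′} → Star _⟶_ c c′ → Config.workHead c′ ≡ Config.workHead c
    workHead-fixed ε = refl
    workHead-fixed {c} (eq ◅ run)
      with readAt input (Config.inputHead c) | eq
    ... | leftEnd  | refl = workHead-fixed run
    ... | symbol _ | refl = workHead-fixed run

  map-logSpace : LogSpaceComputable (List.map h)
  map-logSpace = mapTransducer , halts , 1 , space
    where
    halts : ∀ x → Run.HaltsWith mapTransducer x (List.map h x)
    -- The invariant starts after the first step, which leaves the left end marker without emitting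
    -- anything.
    halts x
      with run-map x 0 x (Run.perform mapTransducer x (Run.initial mapTransducer x) (scan []))
             refl (λ _ → refl) refl
    ... | c′ , run , halt , out = c′ , refl ◅ run , halt , out

    space : ∀ x → Run.UsesSpace≤ mapTransducer x _
    -- The work head stays at 0, so one cell suffices, and the bound is at least 1 even for the
    -- empty input.
    space x c run rewrite workHead-fixed x run = s≤s z≤n

-- Dual formulas and circuits, and their encodings.

dualModality : Modality → Modality
dualModality □ = ◇
dualModality ◇ = □

dualSymbol : ∀ {k m} → Symbol k m → Symbol k m
dualSymbol varS       = varS
dualSymbol sepS       = sepS
dualSymbol (bitS b)   = bitS b
dualSymbol (funS i)   = funS i
dualSymbol (modS o i) = modS (dualModality o) i

-- The families share their arities n definitionally, and M⇒M′ is only an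
-- implication, so that the module applies both to (M , B) ↦ (dual M , dual B)
-- and to the opposite direction.
module Dual (M M′ : ModalitySet) (M⇒M′ : ∀ o → T (M o) → T (M′ (dualModality o)))
            (k : ℕ) {m : ℕ} (n : Fin m → ℕ)
            (f f′ : (i : Fin m) → Vec Bool (n i) → Bool) where

  B B′ : BoolFuns m
  B  i = n i , f i
  B′ i = n i , f′ i

  dualLabel : Label M k m → Label M′ k m
  dualLabel (var x)     = var x
  dualLabel (fun i)     = fun i
  dualLabel (mod o p i) = mod (dualModality o) (M⇒M′ o p) i

  -- The two arities become definitionally equal only once the label is known; after the case split
  -- the coercion is the identity.
  retype : ∀ {a} {A : Set a} (l : Label M k m) →
           Vec A (arity B l) → Vec A (arity B′ (dualLabel l))
  retype (var _)     xs = xs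
  retype (fun _)     xs = xs
  retype (mod _ _ _) xs = xs

  toList-retype : ∀ {a} {A : Set a} l (xs : Vec A (arity B l)) →
                  Vec.toList (retype l xs) ≡ Vec.toList xs
  toList-retype (var _)     xs = refl
  toList-retype (fun _)     xs = refl
  toList-retype (mod _ _ _) xs = refl

  lookup-retype : ∀ {a} {A : Set a} l (xs : Vec A (arity B l)) j →
                  ∃[ j′ ] lookup xs j′ ≡ lookup (retype l xs) j
  lookup-retype (var _)     xs j = j , refl
  lookup-retype (fun _)     xs j = j , refl
  lookup-retype (mod _ _ _) xs j = j , refl

  mutual
    dualFormula : Formula M k B → Formula M′ k B′
    dualFormula (node l φs) = node (dualLabel l) (retype l (dualFormulas φs))

    dualFormulas : ∀ {j} → Vec (Formula M k B) j → Vec (Formula M′ k B′) j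
    dualFormulas []       = []
    dualFormulas (φ ∷ φs) = dualFormula φ ∷ dualFormulas φs

  dualFormulas-tabulate : ∀ {j} (φ : Fin j → Formula M k B) →
                          dualFormulas (tabulate φ) ≡ tabulate (dualFormula ∘ φ)
  dualFormulas-tabulate {zero}  φ = refl
  dualFormulas-tabulate {suc j} φ =
    cong (dualFormula (φ zero) ∷_) (dualFormulas-tabulate (φ ∘ suc))

  dualCircuit : Circuit M k B → Circuit M′ k B′
  dualCircuit c = record
    { size    = size
    ; label   = dualLabel ∘ label
    ; inputs  = λ g → retype (label g) (inputs g)
    ; output  = output
    ; acyclic = λ g → acyclic g ∘ path
    }
    where
    open Circuit c
    edge : ∀ {g h} → ∃[ j ] lookup (retype (label h) (inputs h)) j ≡ g → g ⇝ h
    edge {h = h} (j , eq) with lookup-retype (label h) (inputs h) j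
    ... | j′ , eq′ = j′ , trans eq′ eq

    path : ∀ {g h} →
           TransClosure (λ g h → ∃[ j ] lookup (retype (label h) (inputs h)) j ≡ g) g h →
           TransClosure _⇝_ g h
    path [ e ]    = [ edge e ]
    path (e ∷ es) = edge e ∷ path es

  -- The positions `j` and `j′` have different types until `l` is known, so the hypothesis matches
  -- them through the entries found there.
  tabulate-retype : ∀ {A : Set} l (xs : Vec A (arity B l)) φ φ′ →
    (∀ j j′ → lookup xs j ≡ lookup (retype l xs) j′ → φ′ j′ ≡ dualFormula (φ j)) →
    tabulate φ′ ≡ retype l (dualFormulas (tabulate φ))
  tabulate-retype (var _)     xs φ φ′ eq = refl
  tabulate-retype (fun _)     xs φ φ′ eq =
    trans (Vec.tabulate-cong λ j → eq j j refl) (sym (dualFormulas-tabulate φ))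
  tabulate-retype (mod _ _ _) xs φ φ′ eq =
    trans (Vec.tabulate-cong λ j → eq j j refl) (sym (dualFormulas-tabulate φ))

  module _ (c : Circuit M k B) where
    private
      module C = Circuit c
      module D = Circuit (dualCircuit c)

    -- Induction on accessibility. The proofs `a` and `a′` concern different edge relations and are
    -- kept arbitrary; the sources of matching edges are only propositionally equal, hence `g ≡ h`.
    unfoldGate-dual : ∀ {g h} → g ≡ h → (a : Acc C._⇝_ g) (a′ : Acc D._⇝_ h) →
                      D.unfoldGate h a′ ≡ dualFormula (C.unfoldGate g a)
    unfoldGate-dual {g} refl (acc rs) (acc rs′) =
      cong (node _) (tabulate-retype (C.label g) (C.inputs g) _ _
        λ j j′ eq → unfoldGate-dual eq (rs (j , refl)) (rs′ (j′ , refl)))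

    expansion-dual : D.expansion ≡ dualFormula C.expansion
    expansion-dual = unfoldGate-dual refl _ _

  map-dualSymbol-binary : ∀ x → List.map dualSymbol (binary x) ≡ binary {k} {m} x
  map-dualSymbol-binary x = sym (map-∘ _)

  encodeLabel-dual : ∀ l → encodeLabel (dualLabel l) ≡ List.map dualSymbol (encodeLabel l)
  encodeLabel-dual (var x)     = cong (varS ∷_) (sym (map-dualSymbol-binary x))
  encodeLabel-dual (fun i)     = refl
  encodeLabel-dual (mod o p i) = refl

  mutual
    encodeFormula-dual : ∀ φ →
      encodeFormula (dualFormula φ) ≡ List.map dualSymbol (encodeFormula φ)
    encodeFormula-dual (node l φs) = trans
      (cong₂ _++_ (encodeLabel-dual l)
        (trans (encodeFormulas-retype l (dualFormulas φs)) (encodeFormulas-dual φs)))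
      (sym (map-++ dualSymbol (encodeLabel l) (encodeFormulas φs)))

    encodeFormulas-dual : ∀ {j} (φs : Vec (Formula M k B) j) →
      encodeFormulas (dualFormulas φs) ≡ List.map dualSymbol (encodeFormulas φs)
    encodeFormulas-dual []       = refl
    encodeFormulas-dual (φ ∷ φs) = trans
      (cong₂ _++_ (encodeFormula-dual φ) (encodeFormulas-dual φs))
      (sym (map-++ dualSymbol (encodeFormula φ) (encodeFormulas φs)))

    encodeFormulas-retype : ∀ l (φs : Vec (Formula M′ k B′) (arity B l)) →
      encodeFormulas (retype l φs) ≡ encodeFormulas φs
    encodeFormulas-retype (var _)     φs = refl
    encodeFormulas-retype (fun _)     φs = refl
    encodeFormulas-retype (mod _ _ _) φs = refl

  -- Gates keep their numbers, and `dualSymbol` fixes separators and bits, so all addresses survive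
  -- and only the labels change.
  encodeCircuit-dual : ∀ c →
    encodeCircuit (dualCircuit c) ≡ List.map dualSymbol (encodeCircuit c)
  encodeCircuit-dual c = begin
    binary (toℕ output) ++ concatMap _ (allFin size)
      ≡⟨ cong₂ _++_ (sym (map-dualSymbol-binary (toℕ output)))
           (trans (concatMap-cong gate (allFin size))
                  (sym (map-concatMap dualSymbol _ (allFin size)))) ⟩
    List.map dualSymbol (binary (toℕ output)) ++ List.map dualSymbol (concatMap _ (allFin size))
      ≡⟨ map-++ dualSymbol (binary (toℕ output)) _ ⟨
    List.map dualSymbol (encodeCircuit c) ∎
    where
    open ≡-Reasoning
    open Circuit c

    address : Fin size → List (Symbol k m)
    address h = sepS ∷ binary (toℕ h)

    addresses : ∀ hs → concatMap address hs ≡ List.map dualSymbol (concatMap address hs)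
    addresses hs = trans
      (concatMap-cong (λ h → cong (sepS ∷_) (sym (map-dualSymbol-binary (toℕ h)))) hs)
      (sym (map-concatMap dualSymbol address hs))

    gate : ∀ g →
      encodeLabel (dualLabel (label g)) ++
        concatMap address (Vec.toList (retype (label g) (inputs g))) ≡
      List.map dualSymbol (encodeLabel (label g) ++ concatMap address (Vec.toList (inputs g)))
    gate g = trans
      (cong₂ _++_ (encodeLabel-dual (label g))
        (trans (cong (concatMap address) (toList-retype (label g) (inputs g)))
               (addresses (Vec.toList (inputs g)))))
      (sym (map-++ dualSymbol (encodeLabel (label g)) _))

-- Truth values and the duality of satisfaction.

module _ {ℓ : Level} (em : ExcludedMiddle ℓ) {k : ℕ} (𝓜 : Model k ℓ)
         {M : ModalitySet} {m : ℕ} {B : BoolFuns m} where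
  open Model 𝓜

  -- Together with uniqueness below, this lets the existential clause of `⊨` evaluate a Boolean
  -- function at one definite vector.
  truthValues : ∀ {j} w (φs : Vec (Formula M k B) j) → ∃[ bs ] TruthValues 𝓜 w φs bs
  truthValues w []       = [] , _
  truthValues w (φ ∷ φs) with em {_⊨_ 𝓜 w φ} | truthValues w φs
  ... | yes p | bs , tv = true  ∷ bs , mk⇔ (λ _ → p) (λ _ → refl) , tv
  ... | no ¬p | bs , tv = false ∷ bs , mk⇔ (λ ()) (λ p → contradiction p ¬p) , tv

  truthValues-unique : ∀ {j} w (φs : Vec (Formula M k B) j) {bs cs} →
    TruthValues 𝓜 w φs bs → TruthValues 𝓜 w φs cs → bs ≡ cs
  truthValues-unique w []       {[]}     {[]}     _        _        = refl
  truthValues-unique w (φ ∷ φs) {b ∷ bs} {c ∷ cs} (p , ps) (q , qs) =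
    cong₂ _∷_ (⇔→≡ (mk⇔ (from q ∘ to p) (from p ∘ to q)))
      (truthValues-unique w φs ps qs)

complementModel : ∀ {k ℓ} → Model k ℓ → Model k ℓ
complementModel 𝓜 = record { frame = frame ; π = λ x w → ¬ π x w }
  where open Model 𝓜

-- The equation `f′-dual` holds both when `f′` is defined as the dual of `f` and when `f` is defined
-- as the dual of `f′`, so it serves both reductions.
module Semantics (M M′ : ModalitySet) (M⇒M′ : ∀ o → T (M o) → T (M′ (dualModality o)))
                 (k : ℕ) {m : ℕ} (n : Fin m → ℕ)
                 (f f′ : (i : Fin m) → Vec Bool (n i) → Bool)
                 (f′-dual : ∀ i bs → f′ i (Vec.map not bs) ≡ not (f i bs))
                 {ℓ : Level} (em : ExcludedMiddle ℓ) where
  open Dual M M′ M⇒M′ k n f f′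

  stable : {P : Set ℓ} → ¬ ¬ P → P
  stable = decidable-stable em

  -- Either valuation may be the one given and the other its complement; complementing twice
  -- restores a valuation only up to equivalence.
  module _ (fr : KFrame k ℓ) (π π′ : ℕ → Pred (KFrame.World fr) ℓ)
           (π′-dual : ∀ x w → π′ x w ⇔ (¬ π x w)) where
    open KFrame fr

    private
      𝓜 𝓜′ : Model k ℓ
      𝓜  = record { frame = fr ; π = π }
      𝓜′ = record { frame = fr ; π = π′ }

    mutual
      ⊨-dual : ∀ w φ → _⊨_ 𝓜′ w (dualFormula φ) ⇔ (¬ _⊨_ 𝓜 w φ)
      ⊨-dual w (node (var x) [])            = π′-dual x w
      ⊨-dual w (node (fun i) φs)            = mk⇔
        -- By uniqueness `bs′` is the negation of `bs`, so `f′` and `f` take opposite values and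
        -- cannot both be true.
        (λ { (bs′ , tv′ , eq′) (bs , tv , eq) → not-¬ (sym eq) (trans (sym eq′) (trans
               (cong (f′ i) (truthValues-unique em 𝓜′ w (dualFormulas φs) tv′
                 (truthValues-dual w φs bs tv)))
               (f′-dual i bs))) })
        -- At the actual truth values `bs` the value of `f` is false, since otherwise `bs` would
        -- witness satisfaction.
        λ ¬sat → let bs , tv = truthValues em 𝓜 w φs in
          Vec.map not bs , truthValues-dual w φs bs tv ,
          trans (f′-dual i bs) (sym (¬-not λ eq → ¬sat (bs , tv , sym eq)))
      ⊨-dual w (node (mod ◇ _ i) (φ ∷ []))  = mk⇔
        (λ { ¬ex (w′ , r , s) → ¬ex (w′ , r , λ s′ → to (⊨-dual w′ φ) s′ s) })
        (λ { ¬ex (w′ , r , ¬s′) → ¬s′ (from (⊨-dual w′ φ) λ s → ¬ex (w′ , r , s)) })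
      ⊨-dual w (node (mod □ _ i) (φ ∷ []))  = mk⇔
        (λ { (w′ , r , s′) ¬ex → ¬ex (w′ , r , to (⊨-dual w′ φ) s′) })
        -- Failure of a box is a doubly negated existential; stability turns it into a diamond.
        (λ ¬¬ex → stable λ ¬ex′ → ¬¬ex λ { (w′ , r , ¬s) →
          ¬ex′ (w′ , r , from (⊨-dual w′ φ) ¬s) })

      truthValues-dual : ∀ {j} w (φs : Vec (Formula M k B) j) bs → TruthValues 𝓜 w φs bs →
                         TruthValues 𝓜′ w (dualFormulas φs) (Vec.map not bs)
      truthValues-dual w []       []       _        = _
      truthValues-dual w (φ ∷ φs) (b ∷ bs) (p , ps) =
        mk⇔ (λ e → from (⊨-dual w φ) λ s → not-¬ (sym (from p s)) (sym e))
            (λ s′ → sym (¬-not λ e → to (⊨-dual w φ) s′ (to p (sym e)))) ,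
        truthValues-dual w φs bs ps

  ⊨-complement : ∀ 𝓜 w φ → _⊨_ (complementModel 𝓜) w (dualFormula φ) ⇔ (¬ _⊨_ 𝓜 w φ)
  ⊨-complement 𝓜 = ⊨-dual frame π (λ x w → ¬ π x w) (λ x w → mk⇔ id id)
    where open Model 𝓜

  -- The variant for a model given on the side of the dual formula; on variables it is double
  -- negation elimination.
  ⊨-complement′ : ∀ 𝓜 w φ → _⊨_ 𝓜 w (dualFormula φ) ⇔ (¬ _⊨_ (complementModel 𝓜) w φ)
  ⊨-complement′ 𝓜 = ⊨-dual frame (λ x w → ¬ π x w) π (λ x w → mk⇔ contradiction stable)
    where open Model 𝓜

  module _ {p : Level} (𝓕 : FrameClass ℓ p) where

    -- Complementing the valuation keeps the frame, hence membership in the class, and exchanges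
    -- models of the dual formula with countermodels of `φ`.
    tautology⇔dual-unsatisfiable : ∀ φ → Tautology 𝓕 φ ⇔ (¬ Satisfiable 𝓕 (dualFormula φ))
    tautology⇔dual-unsatisfiable φ = mk⇔
      (λ { taut (𝓜 , in𝓕 , w , s) →
             to (⊨-complement′ 𝓜 w φ) s (taut (complementModel 𝓜) in𝓕 w) })
      (λ unsat 𝓜 in𝓕 w → stable λ ¬s →
         unsat (complementModel 𝓜 , in𝓕 , w , from (⊨-complement 𝓜 w φ) ¬s))

    unsatisfiable⇔dual-tautology : ∀ φ → (¬ Satisfiable 𝓕 φ) ⇔ Tautology 𝓕 (dualFormula φ)
    unsatisfiable⇔dual-tautology φ = mk⇔
      (λ unsat 𝓜 in𝓕 w → from (⊨-complement′ 𝓜 w φ) λ s →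
         unsat (complementModel 𝓜 , in𝓕 , w , s))
      (λ { taut (𝓜 , in𝓕 , w , s) →
             to (⊨-complement 𝓜 w φ) (taut (complementModel 𝓜) in𝓕 w) s })

-- The reductions.

module _ {ℓ p : Level} (𝓕 : FrameClass ℓ p) (M M′ : ModalitySet)
         (M⇒M′ : ∀ o → T (M o) → T (M′ (dualModality o)))
         (k : ℕ) {m : ℕ} (n : Fin m → ℕ)
         (f f′ : (i : Fin m) → Vec Bool (n i) → Bool) where
  open Dual M M′ M⇒M′ k n f f′

  module _ (P : Pred (Formula M k B) (lsuc ℓ ⊔ p)) (P′ : Pred (Formula M′ k B′) (lsuc ℓ ⊔ p))
           (P⇔P′ : ∀ φ → P φ ⇔ P′ (dualFormula φ)) where

    circuitProblem-dual : circuitProblem 𝓕 M k B P ≤ₘˡᵒᵍ circuitProblem 𝓕 M′ k B′ P′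
    circuitProblem-dual = List.map dualSymbol , map-logSpace dualSymbol , λ c →
      dualCircuit c , encodeCircuit-dual c ,
      subst (λ φ → P (Circuit.expansion c) ⇔ P′ φ) (sym (expansion-dual c)) (P⇔P′ _)

    formulaProblem-dual : formulaProblem 𝓕 M k B P ≤ₘˡᵒᵍ formulaProblem 𝓕 M′ k B′ P′
    formulaProblem-dual = List.map dualSymbol , map-logSpace dualSymbol ,
      λ { (φ , c , eq) →
        -- The image is an admissible instance because the dual of a circuit expanding to `φ`
        -- expands to the dual of `φ`.
        (dualFormula φ , dualCircuit c , trans (expansion-dual c) (cong dualFormula eq)) ,
        encodeFormula-dual φ , P⇔P′ φ }

theorem4p2 : ∀ {ℓ p} → ExcludedMiddle ℓ →
    ∀ {m} (B : BoolFuns m) (k : ℕ) (𝓕 : FrameClass ℓ p) (M : ModalitySet) →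
    (CTAUT 𝓕 M k B ≡ₘˡᵒᵍ complement (CSAT 𝓕 (dualModalities M) k (dualFuns B))) ×
    (FTAUT 𝓕 M k B ≡ₘˡᵒᵍ complement (FSAT 𝓕 (dualModalities M) k (dualFuns B)))
theorem4p2 em {m} B k 𝓕 M =
  ( circuitProblem-dual 𝓕 M Mᵈ M⇒Mᵈ k n f fᵈ taut unsat (To.tautology⇔dual-unsatisfiable 𝓕)
  , circuitProblem-dual 𝓕 Mᵈ M Mᵈ⇒M k n fᵈ f unsat taut (From.unsatisfiable⇔dual-tautology 𝓕) ) ,
  ( formulaProblem-dual 𝓕 M Mᵈ M⇒Mᵈ k n f fᵈ taut unsat (To.tautology⇔dual-unsatisfiable 𝓕)
  , formulaProblem-dual 𝓕 Mᵈ M Mᵈ⇒M k n fᵈ f unsat taut (From.unsatisfiable⇔dual-tautology 𝓕) )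
  where
  Mᵈ : ModalitySet
  Mᵈ = dualModalities M

  taut  = Tautology {M = M} {k} {B = B} 𝓕
  unsat = λ φ → ¬ Satisfiable {M = Mᵈ} {k} {B = dualFuns B} 𝓕 φ

  -- Splitting `B` into arities and functions makes `B` and `dualFuns B` definitionally the two
  -- families of `Dual`, in either order.
  n : Fin m → ℕ
  n i = proj₁ (B i)

  f fᵈ : (i : Fin m) → Vec Bool (n i) → Bool
  f  i = proj₂ (B i)
  fᵈ i = proj₂ (dualFuns B i)

  M⇒Mᵈ : ∀ o → T (M o) → T (Mᵈ (dualModality o))
  M⇒Mᵈ □ p = p
  M⇒Mᵈ ◇ p = p

  Mᵈ⇒M : ∀ o → T (Mᵈ o) → T (M (dualModality o))
  Mᵈ⇒M □ p = p
  Mᵈ⇒M ◇ p = p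

  map-not-involutive : ∀ {j} (bs : Vec Bool j) → Vec.map not (Vec.map not bs) ≡ bs
  map-not-involutive bs = trans (sym (Vec.map-∘ not not bs))
    (trans (Vec.map-cong not-involutive bs) (Vec.map-id bs))

  module To   = Semantics M Mᵈ M⇒Mᵈ k n f fᵈ
    (λ i bs → cong (not ∘ f i) (map-not-involutive bs)) em
  module From = Semantics Mᵈ M Mᵈ⇒M k n fᵈ f
    (λ i bs → sym (not-involutive (f i (Vec.map not bs)))) em
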